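{- Let $q$ be a prime power and let $\mathscr{L}_1,\dots,\mathscr{L}_q$ be $q$ distinct parallel classes of affine lines in $\mathbb{F}_q^5$ (so each $\mathscr{L}_i$ consists of all $q^4$ lines with a fixed direction $d_i\in\mathbb{F}_q^5\setminus\{0\}$, and the directions $d_1,\dots,d_q$ are pairwise non-parallel). Let $G_{\mathscr{L}}(q)$ be the bipartite incidence graph between $\mathscr{P}=\mathbb{F}_q^5$ and $\mathscr{L}=\bigcup_{i\in[q]}\mathscr{L}_i$ (a point $x$ is adjacent to a line $\ell$ iff $x\in\ell$). Then for every $\delta>0$ there exists $q_0(\delta)$ such that for every prime power $q\ge q_0(\delta)$ and every such choice of classes, every subgraph $H\subseteq G_{\mathscr{L}}(q)$ with at least $\delta q^6$ edges contains a copy of $C_8$. More precisely, $\operatorname{ex}(G_{\mathscr{L}}(q),C_8)=O(q^{23/4})$ as $q\to\infty$, with the implied constant independent of the choice of parallel classes.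
   Context: For graphs $G$ and $F$, $\operatorname{ex}(G,F)$ denotes the maximum number of edges in an $F$-free subgraph of $G$. $C_8$ is the cycle of length 8. -}

module Defs where

open import Algebra.Apartness.Bundles using (HeytingField)
open import Data.Fin using (Fin; toℕ)
open import Data.Fin.Properties using (any?)
open import Data.Nat as ℕ using (ℕ; suc; _^_; _≤_)
open import Data.Nat.DivMod using (_%_)
open import Data.Nat.Primality using (Prime)
open import Data.Product using (Σ; ∃; ∃-syntax; _×_; _,_; proj₁; proj₂)
open import Data.Sum using (_⊎_; inj₁; inj₂; swap)
open import Data.Sum.Relation.Binary.Pointwise using (_⊎ₛ_; inj₁; inj₂)
open import Data.Vec.Functional using (Vector; map; zipWith; replicate)
open import Function.Bundles using (Inverse; Injection; _⇔_; Equivalence)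
open import Function.Properties.Equivalence using (⇔-isEquivalence)
open import Level using (0ℓ)
open import Relation.Binary using (Setoid; Rel; Symmetric; Irreflexive; _Respects_; _Respects₂_; IsEquivalence)
import Relation.Binary.Construct.On as On
open import Relation.Binary.PropositionalEquality as ≡ using (_≡_; refl)
open import Relation.Nullary using (¬_)
open import Relation.Nullary.Decidable using (from-no)
open import Relation.Unary using (Pred)
import Data.Vec.Functional.Relation.Binary.Equality.Setoid as VecEq

IsPrimePower : ℕ → Set
IsPrimePower q = ∃[ p ] ∃[ k ] Prime p × q ≡ p ^ suc k

HasSize : Setoid 0ℓ 0ℓ → ℕ → Set
HasSize S n = Inverse S (≡.setoid (Fin n))

-- Simple graphs.  Vertices form a setoid, because a line has several
-- representations as a base point together with a direction.

record Graph : Set₁ where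
  infix 4 _~_
  field
    vertices : Setoid 0ℓ 0ℓ
  open Setoid vertices public using (_≈_) renaming (Carrier to Vertex)
  field
    _~_      : Rel Vertex 0ℓ
    ~-resp   : _~_ Respects₂ _≈_
    ~-sym    : Symmetric _~_
    ~-irrefl : Irreflexive _≈_ _~_

  Edge : Set
  Edge = Σ (Vertex × Vertex) λ (u , v) → u ~ v

  -- Edges are unordered: (u , v) and (v , u) are the same edge.
  infix 4 _≈ᴱ_
  _≈ᴱ_ : Rel Edge 0ℓ
  ((u , v) , _) ≈ᴱ ((u′ , v′) , _) = (u ≈ u′ × v ≈ v′) ⊎ (u ≈ v′ × v ≈ u′)

  edges : Setoid 0ℓ 0ℓ
  edges = record
    { Carrier       = Edge
    ; _≈_           = _≈ᴱ_
    ; isEquivalence = record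
      { refl  = inj₁ (V.refl , V.refl)
      ; sym   = λ { (inj₁ (p , r)) → inj₁ (V.sym p , V.sym r)
                  ; (inj₂ (p , r)) → inj₂ (V.sym r , V.sym p) }
      ; trans = λ { (inj₁ (p , r)) (inj₁ (p′ , r′)) → inj₁ (V.trans p p′ , V.trans r r′)
                  ; (inj₁ (p , r)) (inj₂ (p′ , r′)) → inj₂ (V.trans p p′ , V.trans r r′)
                  ; (inj₂ (p , r)) (inj₁ (p′ , r′)) → inj₂ (V.trans p r′ , V.trans r p′)
                  ; (inj₂ (p , r)) (inj₂ (p′ , r′)) → inj₁ (V.trans p r′ , V.trans r p′) }
      }
    } where module V = Setoid vertices

HasEdges : Graph → ℕ → Set
HasEdges G m = HasSize (Graph.edges G) m

record Subgraph (G : Graph) : Set₁ where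
  open Graph G
  infix 4 _~ˢ_
  field
    _∈V       : Pred Vertex 0ℓ
    ∈V-resp   : _∈V Respects _≈_
    _~ˢ_      : Rel Vertex 0ℓ
    ~ˢ-resp   : _~ˢ_ Respects₂ _≈_
    ~ˢ-sym    : Symmetric _~ˢ_
    ~ˢ⇒~      : ∀ {u v} → u ~ˢ v → u ~ v
    ~ˢ⇒∈V     : ∀ {u v} → u ~ˢ v → u ∈V

  graph : Graph
  graph = record
    { vertices = On.setoid {B = Σ Vertex _∈V} vertices proj₁
    ; _~_      = λ u v → proj₁ u ~ˢ proj₁ v
    ; ~-resp   = (λ {u} → proj₁ ~ˢ-resp {proj₁ u}) , (λ {u} → proj₂ ~ˢ-resp {proj₁ u})
    ; ~-sym    = ~ˢ-sym
    ; ~-irrefl = λ u≈v u~v → ~-irrefl u≈v (~ˢ⇒~ u~v)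
    }

-- A copy of F in H; it need not be induced.

record Copy (F H : Graph) : Set where
  private
    module F = Graph F
    module H = Graph H
  field
    embedding : Injection F.vertices H.vertices
  open Injection embedding public using (to)
  field
    preserves : ∀ {u v} → u F.~ v → to u H.~ to v

_IsFreeOf_ : Graph → Graph → Set
H IsFreeOf F = ¬ Copy F H

-- Is-ex G F m says that ex(G,F) = m.

Is-ex : Graph → Graph → ℕ → Set₁
Is-ex G F m =
    (Σ (Subgraph G) λ H → Subgraph.graph H IsFreeOf F × HasEdges (Subgraph.graph H) m)
  × (∀ (H : Subgraph G) k →
       Subgraph.graph H IsFreeOf F → HasEdges (Subgraph.graph H) k → k ≤ m)

C₈ : Graph
C₈ = record
  { vertices = ≡.setoid (Fin 8)
  ; _~_      = λ i j → Next i j ⊎ Next j i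
  ; ~-resp   = ≡.resp₂ _
  ; ~-sym    = swap
  ; ~-irrefl = λ { refl (inj₁ n) → noLoop (_ , n) ; refl (inj₂ n) → noLoop (_ , n) }
  }
  where
  Next : Rel (Fin 8) 0ℓ
  Next i j = toℕ j ≡ suc (toℕ i) % 8

  noLoop : ¬ ∃ λ i → Next i i
  noLoop = from-no (any? {n = 8} λ i → toℕ i ℕ.≟ suc (toℕ i) % 8)

fieldSetoid : HeytingField 0ℓ 0ℓ 0ℓ → Setoid 0ℓ 0ℓ
fieldSetoid 𝔽 = record { isEquivalence = HeytingField.isEquivalence 𝔽 }

-- On a finite carrier equality is decidable and the apartness _#_ is
-- equivalent to inequality, so a finite HeytingField is an ordinary finite field.

module Affine (𝔽 : HeytingField 0ℓ 0ℓ 0ℓ) where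

  open HeytingField 𝔽 using (Carrier; _≈_; _+_; _*_; 0#)
  open VecEq (fieldSetoid 𝔽) public using (_≋_; ≋-sym; ≋-trans; ≋-setoid)

  infixl 6 _+ᵛ_
  infixr 7 _·ᵛ_

  Point : Set
  Point = Vector Carrier 5

  0ᵛ : Point
  0ᵛ = replicate 5 0#

  _+ᵛ_ : Point → Point → Point
  _+ᵛ_ = zipWith _+_

  _·ᵛ_ : Carrier → Point → Point
  t ·ᵛ v = map (t *_) v

  Parallel : Rel Point 0ℓ
  Parallel u v = ∃[ c ] ¬ (c ≈ 0#) × u ≋ c ·ᵛ v

  module Incidence {k : ℕ} (d : Fin k → Point) where

    -- (i , b) stands for the line { b + t · d i ∣ t ∈ 𝔽 }; fixing i and varying b
    -- gives the i-th parallel class.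
    Line : Set
    Line = Fin k × Point

    infix 4 _∈ᴸ_ _≈ᴸ_
    _∈ᴸ_ : Point → Line → Set
    x ∈ᴸ (i , b) = ∃[ t ] x ≋ b +ᵛ t ·ᵛ d i

    -- Lines are equal when they are equal as sets of points.
    _≈ᴸ_ : Rel Line 0ℓ
    ℓ ≈ᴸ ℓ′ = ∀ x → x ∈ᴸ ℓ ⇔ x ∈ᴸ ℓ′

    lines : Setoid 0ℓ 0ℓ
    lines = record
      { _≈_           = _≈ᴸ_
      ; isEquivalence = record
        { refl  = λ _ → E.refl
        ; sym   = λ p x → E.sym (p x)
        ; trans = λ p r x → E.trans (p x) (r x)
        }
      } where module E = IsEquivalence (⇔-isEquivalence {0ℓ})

    data _~_ : Rel (Point ⊎ Line) 0ℓ where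
      point-line : ∀ {x ℓ} → x ∈ᴸ ℓ → inj₁ x ~ inj₂ ℓ
      line-point : ∀ {x ℓ} → x ∈ᴸ ℓ → inj₂ ℓ ~ inj₁ x

    incidenceGraph : Graph
    incidenceGraph = record
      { vertices = ≋-setoid 5 ⊎ₛ lines
      ; _~_      = _~_
      ; ~-resp   = resp , λ p r → ~-sym (resp p (~-sym r))
      ; ~-sym    = ~-sym
      ; ~-irrefl = λ { (inj₁ _) () ; (inj₂ _) () }
      }
      where
      open Setoid (≋-setoid 5 ⊎ₛ lines) using () renaming (_≈_ to _≈ⱽ_)

      ~-sym : Symmetric _~_
      ~-sym (point-line p) = line-point p
      ~-sym (line-point p) = point-line p

      move : ∀ {x y} ℓ → x ≋ y → x ∈ᴸ ℓ → y ∈ᴸ ℓ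
      move _ x≋y (t , p) = t , ≋-trans (≋-sym x≋y) p

      resp : ∀ {u v w} → v ≈ⱽ w → u ~ v → u ~ w
      resp (inj₁ x≋y) (line-point {ℓ = ℓ} p) = line-point (move ℓ x≋y p)
      resp (inj₂ ℓ≈m) (point-line p)         = point-line (Equivalence.to (ℓ≈m _) p)

  open Incidence public using (incidenceGraph)

module Submission where

-- Write x ∼ᵢ y when x and y lie on a common line of direction dᵢ.  The edges of H form a
-- set of flags (x , i), at most q⁶ of them, and an 8-cycle arises from any nondegenerate
-- parallelogram x, y = x + a dᵢ, y′, x′ all of whose vertices carry both flags i and j.
-- By Cauchy–Schwarz there are p ≥ m² / q⁵ triples (x , i , j) with flags (x , i) and (x , j);
-- grouping these by i, j and the i-line through x, there are at least p² / q⁶ pairs of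
-- triples with the same i, j and x ∼ᵢ y.  The pairs with i = j, the pairs with x = y, and,
-- if there is no parallelogram, the remaining ones (determined by i, j, a and the
-- j-line through x) number at most q⁷ each.  Hence m⁴ ≤ q¹⁰ p² ≤ 3 q²³ if H has no C₈.

open import Defs
open import Algebra.Apartness.Bundles using (HeytingField)
open import Algebra.Bundles using (CommutativeRing)
import Algebra.Properties.CommutativeSemigroup as CommutativeSemigroupProperties
import Algebra.Properties.Ring as RingProperties
open import Data.Fin using (Fin; zero; suc; toℕ; combine; fromℕ<; funToFin; finToFun; punchIn; punchOut)
open import Data.Fin.Patterns using (0F; 1F; 2F; 3F; 4F; 5F; 6F; 7F)
open import Data.Fin.Properties as Fin
  using (any?; combine-injective; finToFun-funToFin; pigeonhole; punchIn-punchOut;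
         toℕ-fromℕ<; toℕ-injective; toℕ<n; ¬∀⟶∃¬)
open import Data.Integer as ℤ using (+_; +[1+_])
import Data.Integer.Properties as ℤ
open import Data.List using (List; []; _∷_; _++_; allFin; cartesianProduct; filter; length; lookup; map)
open import Data.List.Membership.Propositional using (_∈_)
open import Data.List.Membership.Propositional.Properties
  using (∈-++⁻; ∈-cartesianProduct⁻; ∈-filter⁻; ∈-lookup)
open import Data.List.Properties using (length-++; length-map; length-tabulate)
open import Data.List.Relation.Unary.All as All using ([]; _∷_)
open import Data.List.Relation.Unary.AllPairs using ([]; _∷_)
open import Data.List.Relation.Unary.Any using (here)
open import Data.List.Relation.Unary.Unique.Propositional using (Unique)
import Data.List.Relation.Unary.Unique.Propositional.Properties as Unique
import Data.List.Relation.Unary.Unique.Setoid as UniqueSetoid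
open import Data.Nat using (ℕ; zero; suc; _^_; _≤_; _<_; _<?_; z≤n; s≤s⁻¹; >-nonZero)
open import Data.Nat.DivMod using (_%_; m%n<n)
import Data.Nat.Properties as ℕₚ
open import Data.Nat.Solver using (module +-*-Solver)
open import Data.Product using (_×_; _,_; ∃-syntax; proj₁; proj₂)
open import Data.Rational as ℚ using (ℚ; 0ℚ; _/_; ↧ₙ_; mkℚ; toℚᵘ)
import Data.Rational.Properties as ℚ
import Data.Rational.Unnormalised as ℚᵘ
import Data.Rational.Unnormalised.Properties as ℚᵘ
open import Data.Sum using (inj₁; inj₂)
open import Data.Sum.Relation.Binary.Pointwise using (inj₁; inj₂)
open import Data.Vec.Functional using (Vector)
open import Function using (_∘_; id)
open import Function.Bundles using (Equivalence; Inverse; mk⇔)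
open import Level using (0ℓ)
open import Relation.Binary using (Decidable; Setoid)
open import Relation.Binary.PropositionalEquality as ≡ using (_≡_; _≢_; cong; cong₂; subst; subst₂)
import Relation.Binary.Reasoning.Setoid as SetoidReasoning
open import Relation.Nullary using (¬_; Dec; yes; no; contradiction)
open import Relation.Nullary.Decidable using (map′; ¬?)
import Relation.Unary as Unary

private variable
  A : Set

-- Counting in lists: Cauchy-Schwarz, the pigeonhole principle and the final exponents.

module _ where

  open import Data.Nat using (_+_; _*_; _≟_)
  open ℕₚ
    using (*-assoc; *-cancelˡ-≤; *-mono-≤; *-monoʳ-≤; *-zeroʳ; +-cancelʳ-≤; +-mono-≤; +-monoˡ-≤;
           +-suc; ≤-reflexive; ≤-trans; ≤∧≢⇒<; module ≤-Reasoning)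
  open ≡ using (refl; sym; trans)

  lookup-injective : (S : Setoid 0ℓ 0ℓ) (let open Setoid S) {xs : List Carrier} → UniqueSetoid.Unique S xs →
    ∀ i j → lookup xs i ≈ lookup xs j → i ≡ j
  lookup-injective S (_ ∷ _) zero zero _ = refl
  lookup-injective S (x∉ ∷ _) zero (suc j) eq = contradiction eq (All.lookup x∉ (∈-lookup j))
  lookup-injective S (x∉ ∷ _) (suc i) zero eq =
    contradiction (Setoid.sym S eq) (All.lookup x∉ (∈-lookup i))
  lookup-injective S (_ ∷ uniq) (suc i) (suc j) eq = cong suc (lookup-injective S uniq i j eq)

  length-filter-¬? : {P : Unary.Pred A 0ℓ} (P? : Unary.Decidable P) (xs : List A) →
    length xs ≡ length (filter P? xs) + length (filter (¬? ∘ P?) xs)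
  length-filter-¬? P? [] = refl
  length-filter-¬? P? (x ∷ xs) with P? x
  ... | yes _ = cong suc (length-filter-¬? P? xs)
  ... | no  _ = trans (cong suc (length-filter-¬? P? xs)) (sym (+-suc _ _))

  length-cartesianProduct : {B : Set} (xs : List A) (ys : List B) →
    length (cartesianProduct xs ys) ≡ length xs * length ys
  length-cartesianProduct [] ys = refl
  length-cartesianProduct (x ∷ xs) ys = trans (length-++ (map (x ,_) ys))
    (cong₂ _+_ (length-map (x ,_) ys) (length-cartesianProduct xs ys))

  -- Lowering both arguments by one removes the same amount from either side, so induction reaches a
  -- zero argument, where the left side vanishes.
  2xy≤x²+y² : ∀ x y → 2 * (x * y) ≤ x * x + y * y
  2xy≤x²+y² zero y = z≤n
  2xy≤x²+y² (suc x) zero = ≤-trans (≤-reflexive (cong (2 *_) (*-zeroʳ x))) z≤n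
  2xy≤x²+y² (suc x) (suc y) = begin
    2 * (suc x * suc y)
      ≡⟨ solve 2 (λ x y → con 2 :* ((con 1 :+ x) :* (con 1 :+ y)) :=
                          con 2 :* (x :* y) :+ (con 2 :+ con 2 :* x :+ con 2 :* y)) refl x y ⟩
    2 * (x * y) + (2 + 2 * x + 2 * y)
      ≤⟨ +-monoˡ-≤ _ (2xy≤x²+y² x y) ⟩
    (x * x + y * y) + (2 + 2 * x + 2 * y)
      ≡⟨ solve 2 (λ x y → (x :* x :+ y :* y) :+ (con 2 :+ con 2 :* x :+ con 2 :* y) :=
                          (con 1 :+ x) :* (con 1 :+ x) :+ (con 1 :+ y) :* (con 1 :+ y)) refl x y ⟩
    suc x * suc x + suc y * suc y ∎
    where
    open ≤-Reasoning
    open +-*-Solver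

  private
    open +-*-Solver

    split : ∀ y z t r → 2 * (y * z * (t + r)) ≡ 2 * ((z * t) * y) + 2 * (y * z * r)
    split = solve 4 (λ y z t r → con 2 :* (y :* z :* (t :+ r)) :=
                                 con 2 :* ((z :* t) :* y) :+ con 2 :* (y :* z :* r)) refl

    merge : ∀ y z t p N → ((z * t) * (z * t) + y * y) + (z * z * p + N * (y * y)) ≡
                          z * z * (t * t + p) + suc N * (y * y)
    merge = solve 5 (λ y z t p N →
      ((z :* t) :* (z :* t) :+ y :* y) :+ (z :* z :* p :+ N :* (y :* y)) :=
      z :* z :* (t :* t :+ p) :+ (con 1 :+ N) :* (y :* y)) refl

    double : ∀ N l → N * (l * l) + N * (l * l) ≡ 2 * (l * N * l)
    double = solve 2 (λ N l → N :* (l :* l) :+ N :* (l :* l) := con 2 :* (l :* N :* l)) refl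

  module _ (f : A → ℕ) where

    -- The bound is Cauchy–Schwarz for the fibre sizes, in a form that is additive
    -- over the fibres: each of them contributes an instance of 2 (zc) y ≤ (zc)² + y².
    collisions-below : ∀ N (xs : List A) → Unique xs → (∀ {x} → x ∈ xs → f x < N) →
      ∃[ ps ] Unique ps
        × (∀ {x y} → (x , y) ∈ ps → x ∈ xs × y ∈ xs × f x ≡ f y)
        × (∀ y z → 2 * (y * z * length xs) ≤ z * z * length ps + N * (y * y))
    collisions-below zero [] _ _ = [] , [] , (λ ()) , bound
      where
      bound : ∀ y z → 2 * (y * z * 0) ≤ z * z * 0 + 0
      bound y z = ≤-trans (≤-reflexive (cong (2 *_) (*-zeroʳ (y * z)))) z≤n
    collisions-below zero (x ∷ xs) _ f< = contradiction (f< (here refl)) λ ()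
    collisions-below (suc N) xs uniq f<
      with ps , ps! , coll , bound ← collisions-below N (filter (λ x → ¬? (f x ≟ N)) xs)
        (Unique.filter⁺ (λ x → ¬? (f x ≟ N)) uniq)
        (λ x∈ → let x∈xs , fx≢N = ∈-filter⁻ (λ x → ¬? (f x ≟ N)) x∈ in
                ≤∧≢⇒< (s≤s⁻¹ (f< x∈xs)) fx≢N)
      -- All ordered pairs within the fibre over `N`, the diagonal included, join the pairs found in
      -- the lower fibres.
      = cartesianProduct top top ++ ps
      , Unique.++⁺ (Unique.cartesianProduct⁺ top! top!) ps! disjoint
      , coll′ , bound′
      where
      top = filter (λ x → f x ≟ N) xs
      rest = filter (λ x → ¬? (f x ≟ N)) xs
      top! = Unique.filter⁺ (λ x → f x ≟ N) uniq

      top-∈ : ∀ {x} → x ∈ top → x ∈ xs × f x ≡ N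
      top-∈ = ∈-filter⁻ (λ x → f x ≟ N)

      rest-∈ : ∀ {x} → x ∈ rest → x ∈ xs × f x ≢ N
      rest-∈ = ∈-filter⁻ (λ x → ¬? (f x ≟ N))

      disjoint : ∀ {p} → ¬ (p ∈ cartesianProduct top top × p ∈ ps)
      disjoint (p∈ , p∈ps) =
        proj₂ (rest-∈ (proj₁ (coll p∈ps)))
          (proj₂ (top-∈ (proj₁ (∈-cartesianProduct⁻ top top p∈))))

      coll′ : ∀ {x y} → (x , y) ∈ cartesianProduct top top ++ ps → x ∈ xs × y ∈ xs × f x ≡ f y
      coll′ p∈ with ∈-++⁻ (cartesianProduct top top) p∈
      ... | inj₁ p∈top =
        let x∈ , y∈ = ∈-cartesianProduct⁻ top top p∈top
            x∈xs , fx = top-∈ x∈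
            y∈xs , fy = top-∈ y∈
        in x∈xs , y∈xs , trans fx (sym fy)
      ... | inj₂ p∈ps =
        let x∈ , y∈ , eq = coll p∈ps in proj₁ (rest-∈ x∈) , proj₁ (rest-∈ y∈) , eq

      bound′ : ∀ y z → 2 * (y * z * length xs) ≤
                       z * z * length (cartesianProduct top top ++ ps) + suc N * (y * y)
      bound′ y z = begin
        2 * (y * z * length xs)
          ≡⟨ cong (λ l → 2 * (y * z * l)) (length-filter-¬? (λ x → f x ≟ N) xs) ⟩
        2 * (y * z * (t + r))
          ≡⟨ split y z t r ⟩
        2 * ((z * t) * y) + 2 * (y * z * r)
          ≤⟨ +-mono-≤ (2xy≤x²+y² (z * t) y) (bound y z) ⟩
        ((z * t) * (z * t) + y * y) + (z * z * p + N * (y * y))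
          ≡⟨ merge y z t p N ⟩
        z * z * (t * t + p) + suc N * (y * y)
          ≡⟨ cong (λ l → z * z * l + suc N * (y * y))
               (trans (length-++ (cartesianProduct top top))
                      (cong (_+ p) (length-cartesianProduct top top))) ⟨
        z * z * length (cartesianProduct top top ++ ps) + suc N * (y * y) ∎
        where
        open ≤-Reasoning
        t = length top
        r = length rest
        p = length ps

  -- With l and p the lengths of `xs` and `ps`, the choice y = l, z = N turns the bound into 2Nl² ≤
  -- N²p + Nl²; cancelling Nl² and then a factor N leaves l² ≤ Np. The case N = 0 is split off
  -- because N is cancelled.
  collisions : ∀ {N} (f : A → Fin N) (xs : List A) → Unique xs →
    ∃[ ps ] Unique ps
      × (∀ {x y} → (x , y) ∈ ps → x ∈ xs × y ∈ xs × f x ≡ f y)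
      × length xs * length xs ≤ N * length ps
  collisions {N = zero} f [] _ = [] , [] , (λ ()) , z≤n
  collisions {N = zero} f (x ∷ _) _ with () ← f x
  collisions {N = N@(suc _)} f xs uniq
    with ps , ps! , coll , bound ← collisions-below (toℕ ∘ f) N xs uniq (λ {x} _ → toℕ<n (f x))
    = ps , ps!
    , (λ p∈ → let x∈ , y∈ , eq = coll p∈ in x∈ , y∈ , toℕ-injective eq)
    , *-cancelˡ-≤ N (+-cancelʳ-≤ (N * (l * l)) _ _ (begin
        N * (l * l) + N * (l * l)  ≡⟨ double N l ⟩
        2 * (l * N * l)            ≤⟨ bound l N ⟩
        N * N * p + N * (l * l)    ≡⟨ cong (_+ N * (l * l)) (*-assoc N N p) ⟩
        N * (N * p) + N * (l * l)  ∎))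
    where
    open ≤-Reasoning
    l = length xs
    p = length ps

  pigeonhole-list : ∀ {N} (f : A → Fin N) {xs : List A} → Unique xs → N < length xs →
    ∃[ x ] ∃[ y ] x ∈ xs × y ∈ xs × x ≢ y × f x ≡ f y
  pigeonhole-list {A} f {xs} uniq N<
    with i , j , i<j , eq ← pigeonhole N< (f ∘ lookup xs)
    = lookup xs i , lookup xs j , ∈-lookup i , ∈-lookup j
    , (λ same → Fin.<⇒≢ i<j (lookup-injective (≡.setoid A) uniq i j same))
    , eq

  -- The factors `q * q`, `q ^ 4` and `q ^ 5` stay unmultiplied because they occur so in the `Fin`
  -- types that number the fibres and the keys.
  count-arithmetic : ∀ q m p r → m * m ≤ q ^ 5 * p → p * p ≤ (q * q) * q ^ 4 * r →
    r ≤ 3 * (q ^ 5 * (q * q)) → m ^ 4 ≤ 3 * q ^ 23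
  count-arithmetic q m p r m²≤ p²≤ r≤ = begin
    m ^ 4
      ≡⟨ solve 1 (λ m → m :^ 4 := (m :* m) :* (m :* m)) refl m ⟩
    (m * m) * (m * m)
      ≤⟨ *-mono-≤ m²≤ m²≤ ⟩
    (q ^ 5 * p) * (q ^ 5 * p)
      ≡⟨ solve 2 (λ q p → (q :^ 5 :* p) :* (q :^ 5 :* p) := q :^ 10 :* (p :* p)) refl q p ⟩
    q ^ 10 * (p * p)
      ≤⟨ *-monoʳ-≤ (q ^ 10) (≤-trans p²≤ (*-monoʳ-≤ ((q * q) * q ^ 4) r≤)) ⟩
    q ^ 10 * ((q * q) * q ^ 4 * (3 * (q ^ 5 * (q * q))))
      ≡⟨ solve 1 (λ q → q :^ 10 :* ((q :* q) :* q :^ 4 :* (con 3 :* (q :^ 5 :* (q :* q)))) :=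
                        con 3 :* q :^ 23) refl q ⟩
    3 * q ^ 23 ∎
    where open ≤-Reasoning

-- Lines of affine 5-space over a finite field.

module FiniteField (𝔽 : HeytingField 0ℓ 0ℓ 0ℓ) {q : ℕ} (size : HasSize (fieldSetoid 𝔽) q) where

  open HeytingField 𝔽 using (isCommutativeRing; tight; #⇒invertible; _#_)
  open Affine 𝔽 using (Point; 0ᵛ; _+ᵛ_; _·ᵛ_; Parallel; _≋_)
  open Inverse size public using () renaming (to to code)
  open Inverse size using (to-cong; strictlyInverseʳ) renaming (from to decode)

  private
    commutativeRing : CommutativeRing 0ℓ 0ℓ
    commutativeRing = record { isCommutativeRing = isCommutativeRing }

  open CommutativeRing commutativeRing
    using (Carrier; _≈_; _+_; _*_; _-_; -_; 0#; 1#; ring; setoid; +-commutativeSemigroup;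
           refl; sym; trans; reflexive; +-cong; +-congˡ; +-congʳ; +-assoc; +-comm; +-identityʳ;
           *-congˡ; *-congʳ; *-assoc; *-comm; *-identityʳ; *-identityˡ;
           zeroˡ; distribʳ; -‿cong; -‿inverseˡ; -‿inverseʳ)
  open CommutativeSemigroupProperties +-commutativeSemigroup using (xy∙z≈xz∙y; interchange)
  open RingProperties ring using (-‿distribˡ-*; -‿+-comm; +-cancelˡ; x≈y⇒x∙y⁻¹≈ε; -0#≈0#)
  open SetoidReasoning setoid

  code-injective : ∀ {x y} → code x ≡ code y → x ≈ y
  code-injective {x} {y} eq =
    trans (sym (strictlyInverseʳ x)) (trans (reflexive (cong decode eq)) (strictlyInverseʳ y))

  infix 4 _≟_
  _≟_ : Decidable _≈_
  x ≟ y = map′ code-injective to-cong (code x Fin.≟ code y)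

  -- The field inverts only elements apart from zero. A search through the finite carrier decides
  -- whether x is invertible; if it fails, x is not apart from zero, and tightness makes it zero.
  inverse : ∀ x → ¬ x ≈ 0# → ∃[ y ] y * x ≈ 1#
  inverse x x≉0 with any? (λ k → decode k * x ≟ 1#)
  ... | yes (k , eq) = decode k , eq
  ... | no none = contradiction (proj₁ (tight x 0#) not-apart) x≉0
    where
    not-apart : ¬ x # 0#
    not-apart x#0 with y , eq , _ ← #⇒invertible x#0 = none (code y , (begin
      decode (code y) * x ≈⟨ *-congʳ (strictlyInverseʳ y) ⟩
      y * x               ≈⟨ *-congˡ (trans (+-congˡ -0#≈0#) (+-identityʳ x)) ⟨
      y * (x - 0#)        ≈⟨ eq ⟩
      1#                  ∎))

  codeᵛ : ∀ {n} → Vector Carrier n → Fin (q ^ n)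
  codeᵛ v = funToFin (code ∘ v)

  codeᵛ-cong : ∀ {n} {v w : Vector Carrier n} → (∀ i → v i ≈ w i) → codeᵛ v ≡ codeᵛ w
  codeᵛ-cong {zero}  _   = ≡.refl
  codeᵛ-cong {suc n} v≈w = cong₂ combine (to-cong (v≈w zero)) (codeᵛ-cong (v≈w ∘ suc))

  codeᵛ-injective : ∀ {n} (v w : Vector Carrier n) → codeᵛ v ≡ codeᵛ w → ∀ i → v i ≈ w i
  codeᵛ-injective v w eq i = code-injective (≡.trans (≡.sym (finToFun-funToFin (code ∘ v) i))
    (≡.trans (cong (λ c → finToFun c i) eq) (finToFun-funToFin (code ∘ w) i)))

  -- The lines with direction d correspond to F⁴: subtracting the multiple of d that
  -- kills a coordinate where d does not vanish leaves four free coordinates.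
  module Direction (d : Point) (d≉0 : ¬ d ≋ 0ᵛ) where

    abstract
      private
        nonvanishing : ∃[ k ] ¬ d k ≈ 0#
        nonvanishing = ¬∀⟶∃¬ 5 (λ k → d k ≈ 0#) (λ k → d k ≟ 0#) d≉0

        pivot : Fin 5
        pivot = proj₁ nonvanishing

        pivot⁻¹ : ∃[ y ] y * d pivot ≈ 1#
        pivot⁻¹ = inverse (d pivot) (proj₂ nonvanishing)

        slope : Point → Carrier
        slope x = x pivot * proj₁ pivot⁻¹

        residue : Point → Point
        residue x j = x j - slope x * d j

        slope-d : slope d ≈ 1#
        slope-d = trans (*-comm _ _) (proj₂ pivot⁻¹)

        -- Because this coordinate always vanishes, `lineCode` may drop it and take `q ^ 4` instead
        -- of `q ^ 5` values.
        residue-pivot : ∀ x → residue x pivot ≈ 0#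
        residue-pivot x = x≈y⇒x∙y⁻¹≈ε (sym (begin
          x pivot * proj₁ pivot⁻¹ * d pivot   ≈⟨ *-assoc _ _ _ ⟩
          x pivot * (proj₁ pivot⁻¹ * d pivot) ≈⟨ *-congˡ (proj₂ pivot⁻¹) ⟩
          x pivot * 1#                        ≈⟨ *-identityʳ _ ⟩
          x pivot                             ∎))

        slope-shift : ∀ {x y t} → y ≋ x +ᵛ t ·ᵛ d → slope y ≈ slope x + t
        slope-shift {x} {y} {t} y≋ = begin
          y pivot * c                   ≈⟨ *-congʳ (y≋ pivot) ⟩
          (x pivot + t * d pivot) * c   ≈⟨ distribʳ _ _ _ ⟩
          x pivot * c + t * d pivot * c ≈⟨ +-congˡ (*-assoc _ _ _) ⟩
          x pivot * c + t * slope d     ≈⟨ +-congˡ (*-congˡ slope-d) ⟩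
          x pivot * c + t * 1#          ≈⟨ +-congˡ (*-identityʳ t) ⟩
          x pivot * c + t               ∎
          where
          c : Carrier
          c = proj₁ pivot⁻¹

        -- Moving by t d raises the slope by t, since d has slope one, so the added multiple of d is
        -- subtracted again.
        residue-shift : ∀ {x y t} → y ≋ x +ᵛ t ·ᵛ d → residue x ≋ residue y
        residue-shift {x} {y} {t} y≋ j = sym (begin
          y j - slope y * d j                            ≈⟨ +-cong (y≋ j) (-‿cong (*-congʳ (slope-shift y≋))) ⟩
          x j + t * d j - (slope x + t) * d j            ≈⟨ +-congˡ (-‿cong (distribʳ _ _ _)) ⟩
          x j + t * d j - (slope x * d j + t * d j)      ≈⟨ +-congˡ (-‿+-comm _ _) ⟨
          x j + t * d j + (- (slope x * d j) - t * d j)  ≈⟨ interchange _ _ _ _ ⟩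
          x j - slope x * d j + (t * d j - t * d j)      ≈⟨ +-congˡ (-‿inverseʳ _) ⟩
          x j - slope x * d j + 0#                       ≈⟨ +-identityʳ _ ⟩
          x j - slope x * d j                            ∎)

      -- The parameter a with y = x + a d when x and y share a line of direction d; for other pairs
      -- it has no such meaning.
      shift : Point → Point → Carrier
      shift x y = slope y - slope x

      lineCode : Point → Fin (q ^ 4)
      lineCode x = codeᵛ (λ j → residue x (punchIn pivot j))

      lineCode-shift : ∀ {x y t} → y ≋ x +ᵛ t ·ᵛ d → lineCode x ≡ lineCode y
      lineCode-shift y≋ = codeᵛ-cong (λ j → residue-shift y≋ (punchIn pivot j))

      lineCode-cong : ∀ {x y} → x ≋ y → lineCode x ≡ lineCode y
      lineCode-cong {x} {y} x≋y = lineCode-shift {t = 0#} λ j →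
        trans (sym (x≋y j)) (sym (trans (+-congˡ (zeroˡ (d j))) (+-identityʳ (x j))))

      lineCode⇒shift : ∀ {x y} → lineCode x ≡ lineCode y → y ≋ x +ᵛ shift x y ·ᵛ d
      lineCode⇒shift {x} {y} eq j = begin
        y j                                            ≈⟨ restore y j ⟨
        residue y j + slope y * d j                    ≈⟨ +-congʳ (same-residue j) ⟨
        x j - slope x * d j + slope y * d j            ≈⟨ +-assoc _ _ _ ⟩
        x j + (- (slope x * d j) + slope y * d j)      ≈⟨ +-congˡ (+-comm _ _) ⟩
        x j + (slope y * d j - slope x * d j)          ≈⟨ +-congˡ (+-congˡ (-‿distribˡ-* _ _)) ⟩
        x j + (slope y * d j + - slope x * d j)        ≈⟨ +-congˡ (distribʳ _ _ _) ⟨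
        x j + (slope y - slope x) * d j                ∎
        where
        restore : ∀ z j → residue z j + slope z * d j ≈ z j
        restore z j = trans (+-assoc _ _ _) (trans (+-congˡ (-‿inverseˡ _)) (+-identityʳ _))

        same-residue : residue x ≋ residue y
        same-residue j with pivot Fin.≟ j
        ... | yes ≡.refl = trans (residue-pivot x) (sym (residue-pivot y))
        ... | no pivot≢j = ≡.subst (λ k → residue x k ≈ residue y k) (punchIn-punchOut pivot≢j)
                             (codeᵛ-injective (residue x ∘ punchIn pivot) (residue y ∘ punchIn pivot) eq (punchOut pivot≢j))

  module TwoDirections {d e : Point} (d≉0 : ¬ d ≋ 0ᵛ) (e≉0 : ¬ e ≋ 0ᵛ) where

    private
      module D = Direction d d≉0
      module E = Direction e e≉0

    -- If y = x + t d = x + s e with t nonzero, then d = (s / t) e, and the factor is nonzero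
    -- because d is, so the directions would be parallel. Hence t = 0 and y = x.
    lines-meet-once : ¬ Parallel d e → ∀ {x y} →
      D.lineCode x ≡ D.lineCode y → E.lineCode x ≡ E.lineCode y → x ≋ y
    lines-meet-once d∦e {x} {y} same-d same-e with D.shift x y ≟ 0#
    ... | yes t≈0 = λ j → sym (begin
      y j                    ≈⟨ D.lineCode⇒shift same-d j ⟩
      x j + D.shift x y * d j ≈⟨ +-congˡ (trans (*-congʳ t≈0) (zeroˡ (d j))) ⟩
      x j + 0#               ≈⟨ +-identityʳ (x j) ⟩
      x j                    ∎)
    ... | no t≉0 = contradiction (u * s , us≉0 , d≋) d∦e
      where
      t = D.shift x y
      s = E.shift x y
      u = proj₁ (inverse t t≉0)

      td≈se : ∀ j → t * d j ≈ s * e j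
      td≈se j = +-cancelˡ (x j) _ _
        (trans (sym (D.lineCode⇒shift same-d j)) (E.lineCode⇒shift same-e j))

      d≋ : d ≋ (u * s) ·ᵛ e
      d≋ j = begin
        d j           ≈⟨ *-identityˡ (d j) ⟨
        1# * d j      ≈⟨ *-congʳ (proj₂ (inverse t t≉0)) ⟨
        u * t * d j   ≈⟨ *-assoc _ _ _ ⟩
        u * (t * d j) ≈⟨ *-congˡ (td≈se j) ⟩
        u * (s * e j) ≈⟨ *-assoc _ _ _ ⟨
        u * s * e j   ∎

      us≉0 : ¬ u * s ≈ 0#
      us≉0 us≈0 = d≉0 λ j → trans (d≋ j) (trans (*-congʳ us≈0) (zeroˡ (e j)))

    -- Both x and x′ move by the same multiple of d, so x′ = x + s e carries over to y′ = y + s e.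
    parallelogram : ∀ {x y x′ y′} → D.lineCode x ≡ D.lineCode y → D.lineCode x′ ≡ D.lineCode y′ →
      E.lineCode x ≡ E.lineCode x′ → D.shift x y ≈ D.shift x′ y′ → E.lineCode y ≡ E.lineCode y′
    parallelogram {x} {y} {x′} {y′} xy x′y′ xx′ shifts = E.lineCode-shift λ j → begin
      y′ j                                               ≈⟨ D.lineCode⇒shift x′y′ j ⟩
      x′ j + D.shift x′ y′ * d j                         ≈⟨ +-cong (E.lineCode⇒shift xx′ j) (*-congʳ (sym shifts)) ⟩
      x j + E.shift x x′ * e j + D.shift x y * d j       ≈⟨ xy∙z≈xz∙y _ _ _ ⟩
      x j + D.shift x y * d j + E.shift x x′ * e j       ≈⟨ +-congʳ (D.lineCode⇒shift xy j) ⟨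
      y j + E.shift x x′ * e j                           ∎

open import Data.Nat using (_*_)

-- Flags of a subgraph and the 8-cycle around a parallelogram.

module IncidenceSubgraph
  (𝔽 : HeytingField 0ℓ 0ℓ 0ℓ) {q : ℕ} (size : HasSize (fieldSetoid 𝔽) q)
  (d : Fin q → Affine.Point 𝔽)
  (d≉0 : ∀ i → ¬ Affine._≋_ 𝔽 (d i) (Affine.0ᵛ 𝔽))
  (d∦ : ∀ i j → i ≢ j → ¬ Affine.Parallel 𝔽 (d i) (d j))
  (H : Subgraph (Affine.incidenceGraph 𝔽 d)) where

  open Affine 𝔽 using (Point; _≋_; ≋-sym; incidenceGraph)
  open FiniteField 𝔽 size
    using (code; code-injective; codeᵛ; codeᵛ-cong; codeᵛ-injective; module Direction; module TwoDirections)
  open HeytingField 𝔽 using (+-cong; *-congʳ) renaming (sym to ≈-sym; trans to ≈-trans)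
  open Affine.Incidence 𝔽 d using (Line; _∈ᴸ_; _≈ᴸ_; lines; point-line)
  open Subgraph H
  module Γ = Graph graph
  module G = Graph (incidenceGraph d)
  module Dir i = Direction (d i) (d≉0 i)
  open Dir using (lineCode; shift; lineCode-shift; lineCode-cong; lineCode⇒shift)
  module TwoDir i j = TwoDirections (d≉0 i) (d≉0 j)

  ∈ᴸ⇒lineCode : ∀ {i b x} → x ∈ᴸ (i , b) → lineCode i b ≡ lineCode i x
  ∈ᴸ⇒lineCode {i} (t , x≋) = lineCode-shift i x≋

  lineCode⇒∈ᴸ : ∀ {i b x} → lineCode i b ≡ lineCode i x → x ∈ᴸ (i , b)
  lineCode⇒∈ᴸ {i} {b} {x} eq = shift i b x , lineCode⇒shift i eq

  -- A point lies on a line of direction i exactly when it has the code of the base point, so base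
  -- points with equal codes give the same point set.
  lineCode⇒≈ᴸ : ∀ {i b c} → lineCode i b ≡ lineCode i c → (i , b) ≈ᴸ (i , c)
  lineCode⇒≈ᴸ eq x = mk⇔
    (λ x∈b → lineCode⇒∈ᴸ (≡.trans (≡.sym eq) (∈ᴸ⇒lineCode x∈b)))
    (λ x∈c → lineCode⇒∈ᴸ (≡.trans eq (∈ᴸ⇒lineCode x∈c)))

  -- The line through x in direction d i is represented with x itself as its base point.
  Flag : Point → Fin q → Set
  Flag x i = inj₁ x ~ˢ inj₂ (i , x)

  -- The point also serves as base point of the line, so both ends of the edge have to be replaced.
  flag-resp : ∀ {x y} i → x ≋ y → Flag x i → Flag y i
  flag-resp i x≋y = proj₂ ~ˢ-resp (inj₁ x≋y) ∘
    proj₁ ~ˢ-resp (inj₂ (lineCode⇒≈ᴸ (lineCode-cong i x≋y)))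

  flag⇒edge : ∀ {i b x} → lineCode i b ≡ lineCode i x → Flag x i → inj₁ x ~ˢ inj₂ (i , b)
  flag⇒edge eq = proj₁ ~ˢ-resp (inj₂ (lineCode⇒≈ᴸ (≡.sym eq)))

  edge⇒flag : ∀ {i b x} → inj₁ x ~ˢ inj₂ (i , b) → Flag x i
  edge⇒flag a with point-line x∈ ← ~ˢ⇒~ a =
    proj₁ ~ˢ-resp (inj₂ (lineCode⇒≈ᴸ (∈ᴸ⇒lineCode x∈))) a

  edge-lineCode : ∀ {i b x} → inj₁ x ~ˢ inj₂ (i , b) → lineCode i b ≡ lineCode i x
  edge-lineCode a with point-line x∈ ← ~ˢ⇒~ a = ∈ᴸ⇒lineCode x∈

  -- One side of a parallelogram: the cycle runs between x and y along their i-line and comes and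
  -- goes along j-lines, which uses all four flags.
  record Span (i j : Fin q) (x y : Point) : Set where
    field
      collinear : lineCode i x ≡ lineCode i y
      flag-xi   : Flag x i
      flag-xj   : Flag x j
      flag-yi   : Flag y i
      flag-yj   : Flag y j

  module _ {i j : Fin q} (i≢j : i ≢ j) {x y x′ y′ : Point}
    (xy : Span i j x y) (x′y′ : Span i j x′ y′)
    (xx′ : lineCode j x ≡ lineCode j x′) (yy′ : lineCode j y ≡ lineCode j y′)
    (x≉y : ¬ x ≋ y) (x≉x′ : ¬ x ≋ x′) where

    private
      module XY = Span xy
      module X′Y′ = Span x′y′

      point : ∀ z (i : Fin q) → Flag z i → Γ.Vertex
      point z _ a = inj₁ z , ~ˢ⇒∈V a

      line : (i : Fin q) → ∀ z → Flag z i → Γ.Vertex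
      line i z a = inj₂ (i , z) , ~ˢ⇒∈V (~ˢ-sym a)

      -- Vertices and sides alternate around the parallelogram x, y, y′, x′. Each line is based at a
      -- vertex with the matching flag, which puts it into the subgraph.
      cycle : List Γ.Vertex
      cycle = point x i XY.flag-xi
            ∷ line i x XY.flag-xi
            ∷ point y i XY.flag-yi
            ∷ line j y XY.flag-yj
            ∷ point y′ i X′Y′.flag-yi
            ∷ line i x′ X′Y′.flag-xi
            ∷ point x′ i X′Y′.flag-xi
            ∷ line j x XY.flag-xj
            ∷ []

      meet : ∀ {u v} → lineCode i u ≡ lineCode i v → lineCode j u ≡ lineCode j v → u ≋ v
      meet = TwoDir.lines-meet-once i j (d∦ i j i≢j)

      x≁y : lineCode j x ≢ lineCode j y
      x≁y eq = x≉y (meet XY.collinear eq)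

      x≁x′ : lineCode i x ≢ lineCode i x′
      x≁x′ eq = x≉x′ (meet eq xx′)

      ≈ᴸ⇒lineCode : ∀ {k l u v} → (k , u) ≈ᴸ (l , v) →
        ∀ w → lineCode k u ≡ lineCode k w → lineCode l v ≡ lineCode l w
      ≈ᴸ⇒lineCode eq w u∼w = ∈ᴸ⇒lineCode (Equivalence.to (eq w) (lineCode⇒∈ᴸ u∼w))

      -- Equal lines would put u and v on a common j-line as well as a common i-line, forcing u = v.
      i-line≉j-line : ∀ {u v w} → lineCode i u ≡ lineCode i v → ¬ u ≋ v → ¬ (i , u) ≈ᴸ (j , w)
      i-line≉j-line {u} {v} u∼v u≉v eq = u≉v (meet u∼v
        (≡.trans (≡.sym (≈ᴸ⇒lineCode eq u ≡.refl)) (≈ᴸ⇒lineCode eq v u∼v)))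

      open ≡ using (trans; sym)

      x′≉y′ : ¬ x′ ≋ y′
      x′≉y′ eq = x≁y (trans xx′ (trans (lineCode-cong j eq) (sym yy′)))

      -- Points and lines never coincide, which leaves six pairs of points and six pairs of lines.
      -- Parallel lines are told apart by `x≁y` and `x≁x′`, lines of different direction by
      -- `i-line≉j-line`.
      distinct : UniqueSetoid.Unique Γ.vertices cycle
      distinct =
          ((λ ()) ∷ pts x≉y ∷ (λ ()) ∷ pts x≉y′ ∷ (λ ()) ∷ pts x≉x′ ∷ (λ ()) ∷ [])
        ∷ ((λ ()) ∷ lns xi≉yj ∷ (λ ()) ∷ lns xi≉x′i ∷ (λ ()) ∷ lns xi≉xj ∷ [])
        ∷ ((λ ()) ∷ pts y≉y′ ∷ (λ ()) ∷ pts y≉x′ ∷ (λ ()) ∷ [])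
        ∷ ((λ ()) ∷ lns yj≉x′i ∷ (λ ()) ∷ lns yj≉xj ∷ [])
        ∷ ((λ ()) ∷ pts y′≉x′ ∷ (λ ()) ∷ [])
        ∷ ((λ ()) ∷ lns x′i≉xj ∷ [])
        ∷ ((λ ()) ∷ [])
        ∷ [] ∷ []
        where
        pts : ∀ {u v} → ¬ u ≋ v → ¬ inj₁ u G.≈ inj₁ v
        pts u≉v (inj₁ eq) = u≉v eq

        lns : ∀ {u v} → ¬ u ≈ᴸ v → ¬ inj₂ u G.≈ inj₂ v
        lns u≉v (inj₂ eq) = u≉v eq

        x≉y′ : ¬ x ≋ y′
        x≉y′ eq = x≁y (trans (lineCode-cong j eq) (sym yy′))

        y≉y′ : ¬ y ≋ y′
        y≉y′ eq = x≁x′ (trans XY.collinear (trans (lineCode-cong i eq) (sym X′Y′.collinear)))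

        y≉x′ : ¬ y ≋ x′
        y≉x′ eq = x≁y (trans xx′ (sym (lineCode-cong j eq)))

        y′≉x′ : ¬ y′ ≋ x′
        y′≉x′ eq = x′≉y′ (≋-sym eq)

        xi≉yj : ¬ (i , x) ≈ᴸ (j , y)
        xi≉yj = i-line≉j-line XY.collinear x≉y

        xi≉xj : ¬ (i , x) ≈ᴸ (j , x)
        xi≉xj = i-line≉j-line XY.collinear x≉y

        xi≉x′i : ¬ (i , x) ≈ᴸ (i , x′)
        xi≉x′i eq = x≁x′ (sym (≈ᴸ⇒lineCode eq x ≡.refl))

        yj≉x′i : ¬ (j , y) ≈ᴸ (i , x′)
        yj≉x′i eq = i-line≉j-line X′Y′.collinear x′≉y′ (Setoid.sym lines {j , y} {i , x′} eq)

        yj≉xj : ¬ (j , y) ≈ᴸ (j , x)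
        yj≉xj eq = x≁y (≈ᴸ⇒lineCode eq y ≡.refl)

        x′i≉xj : ¬ (i , x′) ≈ᴸ (j , x)
        x′i≉xj = i-line≉j-line X′Y′.collinear x′≉y′

      next : Fin 8 → Fin 8
      next k = fromℕ< (m%n<n (suc (toℕ k)) 8)

      step : ∀ k → lookup cycle k Γ.~ lookup cycle (next k)
      step 0F = XY.flag-xi
      step 1F = ~ˢ-sym (flag⇒edge XY.collinear XY.flag-yi)
      step 2F = XY.flag-yj
      step 3F = ~ˢ-sym (flag⇒edge yy′ X′Y′.flag-yj)
      step 4F = flag⇒edge X′Y′.collinear X′Y′.flag-yi
      step 5F = ~ˢ-sym X′Y′.flag-xi
      step 6F = flag⇒edge xx′ X′Y′.flag-xj
      step 7F = ~ˢ-sym XY.flag-xj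

      -- The equation forces l to be `next k`, so the eight edges of `step` suffice.
      step-to : ∀ k l → toℕ l ≡ suc (toℕ k) % 8 → lookup cycle k Γ.~ lookup cycle l
      step-to k l eq = subst (λ l → lookup cycle k Γ.~ lookup cycle l)
        (toℕ-injective (trans (toℕ-fromℕ< _) (sym eq))) (step k)

    parallelogram⇒C₈ : Copy C₈ graph
    parallelogram⇒C₈ = record
      { embedding = record
        { to        = lookup cycle
        ; cong      = Setoid.reflexive Γ.vertices ∘ cong (lookup cycle)
        ; injective = lookup-injective Γ.vertices distinct _ _
        }
      ; preserves = λ { {k} {l} (inj₁ eq) → step-to k l eq
                      ; {k} {l} (inj₂ eq) → ~ˢ-sym (step-to l k eq) }
      }

  -- Orienting edges from points to lines.

  record OrientedEdge : Set where
    constructor orientedEdge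
    field
      {point} : Point
      {line}  : Line
      edge    : inj₁ point ~ˢ inj₂ line

  orient : Γ.Edge → OrientedEdge
  orient (((inj₁ x , _) , (inj₁ y , _)) , a) with () ← ~ˢ⇒~ a
  orient (((inj₁ x , _) , (inj₂ ℓ , _)) , a) = orientedEdge a
  orient (((inj₂ ℓ , _) , (inj₁ x , _)) , a) = orientedEdge (~ˢ-sym a)
  orient (((inj₂ ℓ , _) , (inj₂ k , _)) , a) with () ← ~ˢ⇒~ a

  open OrientedEdge

  -- An edge may list its ends in two orders; both give the same oriented edge, and `_≈ᴱ_`
  -- identifies these two orders.
  orient-injective : ∀ u v → point (orient u) ≋ point (orient v) → line (orient u) ≈ᴸ line (orient v) →
    u Γ.≈ᴱ v
  orient-injective (((inj₁ _ , _) , (inj₁ _ , _)) , a) _ _ _ with () ← ~ˢ⇒~ a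
  orient-injective (((inj₂ _ , _) , (inj₂ _ , _)) , a) _ _ _ with () ← ~ˢ⇒~ a
  orient-injective _ (((inj₁ _ , _) , (inj₁ _ , _)) , a) _ _ with () ← ~ˢ⇒~ a
  orient-injective _ (((inj₂ _ , _) , (inj₂ _ , _)) , a) _ _ with () ← ~ˢ⇒~ a
  orient-injective (((inj₁ _ , _) , (inj₂ _ , _)) , _) (((inj₁ _ , _) , (inj₂ _ , _)) , _) p ℓ =
    inj₁ (inj₁ p , inj₂ ℓ)
  orient-injective (((inj₁ _ , _) , (inj₂ _ , _)) , _) (((inj₂ _ , _) , (inj₁ _ , _)) , _) p ℓ =
    inj₂ (inj₁ p , inj₂ ℓ)
  orient-injective (((inj₂ _ , _) , (inj₁ _ , _)) , _) (((inj₁ _ , _) , (inj₂ _ , _)) , _) p ℓ =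
    inj₂ (inj₂ ℓ , inj₁ p)
  orient-injective (((inj₂ _ , _) , (inj₁ _ , _)) , _) (((inj₂ _ , _) , (inj₁ _ , _)) , _) p ℓ =
    inj₁ (inj₂ ℓ , inj₁ p)

  -- Counting pairs of flags at a point, and pairs of such pairs along a line.

  module Counting {m : ℕ} (edges : HasEdges graph m) where

    open Inverse edges using (from; strictlyInverseˡ) renaming (to-cong to number-cong)

    pointOf : Fin m → Point
    pointOf e = point (orient (from e))

    index : Fin m → Fin q
    index e = proj₁ (line (orient (from e)))

    pointCode : Fin m → Fin (q ^ 5)
    pointCode e = codeᵛ (pointOf e)

    pointCode⇒≋ : ∀ {e f} → pointCode e ≡ pointCode f → pointOf e ≋ pointOf f
    pointCode⇒≋ = codeᵛ-injective _ _

    flag : ∀ e → Flag (pointOf e) (index e)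
    flag e = edge⇒flag (edge (orient (from e)))

    flagAt : ∀ {e f i} → pointCode e ≡ pointCode f → index e ≡ i → Flag (pointOf f) i
    flagAt {e} p ≡.refl = flag-resp (index e) (pointCode⇒≋ p) (flag e)

    -- A point lies on just one line of each direction, so point and direction recover the edge up
    -- to `_≈ᴱ_`, and hence its number.
    edge-determined : ∀ {e f} → pointCode e ≡ pointCode f → index e ≡ index f → e ≡ f
    edge-determined {e} {f} p i = ≡.trans (≡.sym (strictlyInverseˡ e))
      (≡.trans (number-cong (orient-injective (from e) (from f) (pointCode⇒≋ p) (same-line p i)))
               (strictlyInverseˡ f))
      where
      same-line : ∀ {e f} → pointCode e ≡ pointCode f → index e ≡ index f →
        line (orient (from e)) ≈ᴸ line (orient (from f))
      same-line {e} {f} p i = glue i (edge (orient (from e))) (edge (orient (from f))) (pointCode⇒≋ p)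
        where
        -- The lines become variables here, so that the equation between their directions can be
        -- matched with `refl`.
        glue : ∀ {x y ℓ k} → proj₁ ℓ ≡ proj₁ k → inj₁ x ~ˢ inj₂ ℓ → inj₁ y ~ˢ inj₂ k → x ≋ y → ℓ ≈ᴸ k
        glue {ℓ = i , _} ≡.refl a b x≋y = lineCode⇒≈ᴸ
          (≡.trans (edge-lineCode a) (≡.trans (lineCode-cong i x≋y) (≡.sym (edge-lineCode b))))

    -- Two edges at one point x stand for a triple (x , i , j) with flags i and j at x, where i = j
    -- is allowed; `IsCherry` demands the common point.
    Cherry : Set
    Cherry = Fin m × Fin m

    IsCherry : Cherry → Set
    IsCherry (e , e′) = pointCode e ≡ pointCode e′

    segmentCode : Cherry → Fin ((q * q) * q ^ 4)
    segmentCode (e , e′) = combine (combine (index e) (index e′)) (lineCode (index e) (pointOf e))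

    -- Equal segment codes mean equal i, equal j and a common i-line, so a linked pair is a
    -- candidate for a side of a parallelogram.
    record Linked (P : Cherry × Cherry) : Set where
      field
        cherry₁      : IsCherry (proj₁ P)
        cherry₂      : IsCherry (proj₂ P)
        segmentCode≡ : segmentCode (proj₁ P) ≡ segmentCode (proj₂ P)

    module _ {e e′ g g′ : Fin m} (linked : Linked ((e , e′) , (g , g′))) where
      open Linked linked

      private
        parts = combine-injective (combine (index e) (index e′)) (lineCode (index e) (pointOf e))
          (combine (index g) (index g′)) (lineCode (index g) (pointOf g)) segmentCode≡
        indices = combine-injective (index e) (index e′) (index g) (index g′) (proj₁ parts)

      linked-index : index g ≡ index e
      linked-index = ≡.sym (proj₁ indices)

      linked-index′ : index g′ ≡ index e′
      linked-index′ = ≡.sym (proj₂ indices)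

      linked-span : Span (index e) (index e′) (pointOf e) (pointOf g)
      linked-span = record
        { collinear = ≡.trans (proj₂ parts) (cong (λ i → lineCode i (pointOf g)) linked-index)
        ; flag-xi   = flag e
        ; flag-xj   = flagAt {e′} (≡.sym cherry₁) ≡.refl
        ; flag-yi   = flagAt {g} ≡.refl linked-index
        ; flag-yj   = flagAt {g′} (≡.sym cherry₂) linked-index′
        }

    -- The edges e, e′ lie at x and g, g′ at y, with directions i, j, i, j; so i, j, x and y
    -- determine all four.
    linked-determined : ∀ {e e′ g g′ f f′ h h′} →
      Linked ((e , e′) , (g , g′)) → Linked ((f , f′) , (h , h′)) →
      index e ≡ index f → index e′ ≡ index f′ →
      pointCode e ≡ pointCode f → pointCode g ≡ pointCode h →
      _≡_ {A = Cherry × Cherry} ((e , e′) , (g , g′)) ((f , f′) , (h , h′))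
    linked-determined P Q i i′ p p′ = cong₂ _,_
      (cong₂ _,_ (edge-determined p i)
                 (edge-determined (trans (sym P.cherry₁) (trans p Q.cherry₁)) i′))
      (cong₂ _,_ (edge-determined p′ (trans (linked-index P) (trans i (sym (linked-index Q)))))
                 (edge-determined (trans (sym P.cherry₂) (trans p′ Q.cherry₂))
                   (trans (linked-index′ P) (trans i′ (sym (linked-index′ Q))))))
      where
      module P = Linked P
      module Q = Linked Q
      open ≡ using (trans; sym)

    shiftCode : Fin m → Fin m → Fin q
    shiftCode e g = code (shift (index e) (pointOf e) (pointOf g))

    endpoint-determined : ∀ {i i′ j j′ x x′ y y′} → Span i j x y → Span i′ j′ x′ y′ → i ≡ i′ → x ≋ x′ →
      code (shift i x y) ≡ code (shift i′ x′ y′) → y ≋ y′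
    endpoint-determined {i} xy x′y′ ≡.refl x≋x′ eq k = ≈-trans (lineCode⇒shift i (Span.collinear xy) k)
      (≈-trans (+-cong (x≋x′ k) (*-congʳ (code-injective eq)))
               (≈-sym (lineCode⇒shift i (Span.collinear x′y′) k)))

    Key : Set
    Key = Fin 3 × Fin (q ^ 5) × Fin q × Fin q

    encode : Key → Fin (3 * (q ^ 5 * (q * q)))
    encode (t , a , b , c) = combine t (combine a (combine b c))

    encode-injective : ∀ u v → encode u ≡ encode v → u ≡ v
    encode-injective (t , a , b , c) (t′ , a′ , b′ , c′) eq =
      let t≡ , rest = combine-injective t (combine a (combine b c)) t′ (combine a′ (combine b′ c′)) eq
          a≡ , rest′ = combine-injective a (combine b c) a′ (combine b′ c′) rest
          b≡ , c≡ = combine-injective b c b′ c′ rest′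
      in cong₂ _,_ t≡ (cong₂ _,_ a≡ (cong₂ _,_ b≡ c≡))

    -- The tag separates the two degenerate kinds of pairs, i = j and x = y, from the others,
    -- whose second component lies in Fin (q * q ^ 4), which is Fin (q ^ 5) definitionally.
    key : ∀ e e′ g → Dec (index e ≡ index e′) → Dec (pointCode e ≡ pointCode g) → Key
    key e e′ g (yes _) _       = 0F , pointCode e , shiftCode e g , index e
    key e e′ g (no _)  (yes _) = 1F , pointCode e , index e , index e′
    key e e′ g (no _)  (no _)  =
      2F , combine (shiftCode e g) (lineCode (index e′) (pointOf e)) , index e , index e′

    keyOf : Cherry × Cherry → Key
    keyOf ((e , e′) , (g , _)) =
      key e e′ g (index e Fin.≟ index e′) (pointCode e Fin.≟ pointCode g)

    -- Tag `0F` records x, i and the shift a, hence y = x + a dᵢ, while j = i; tag `1F` records x,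
    -- i, j, while y = x. Either way the key determines the pair. Under tag `2F`, equal i, j, a and
    -- j-line of x give a parallelogram, and x = x′ would again make the pairs equal. The decisions
    -- are arguments so that `key` computes when they are matched.
    collision⇒C₈ : ∀ {e e′ g g′ f f′ h h′} →
      Linked ((e , e′) , (g , g′)) → Linked ((f , f′) , (h , h′)) →
      _≢_ {A = Cherry × Cherry} ((e , e′) , (g , g′)) ((f , f′) , (h , h′)) →
      (e∥e′ : Dec (index e ≡ index e′)) (e∙g : Dec (pointCode e ≡ pointCode g)) →
      (f∥f′ : Dec (index f ≡ index f′)) (f∙h : Dec (pointCode f ≡ pointCode h)) →
      key e e′ g e∥e′ e∙g ≡ key f f′ h f∥f′ f∙h → Copy C₈ graph
    collision⇒C₈ {e} {e′} {g} {g′} {f} {f′} {h} {h′} P Q P≢Q = go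
      where
      open ≡ using (sym) renaming (trans to infixr 5 _∙_)

      far-end : index e ≡ index f → pointCode e ≡ pointCode f → shiftCode e g ≡ shiftCode f h →
        pointCode g ≡ pointCode h
      far-end i p s = codeᵛ-cong
        (endpoint-determined (linked-span P) (linked-span Q) i (pointCode⇒≋ p) s)

      close : ∀ {i j i′ j′ x y x′ y′} → i ≡ i′ → j ≡ j′ → i ≢ j → ¬ x ≋ y → ¬ x ≋ x′ →
        Span i j x y → Span i′ j′ x′ y′ → code (shift i x y) ≡ code (shift i′ x′ y′) →
        lineCode j x ≡ lineCode j′ x′ → Copy C₈ graph
      close {i} {j} ≡.refl ≡.refl i≢j x≉y x≉x′ xy x′y′ s xx′ =
        parallelogram⇒C₈ i≢j xy x′y′ xx′
          (TwoDir.parallelogram i j (Span.collinear xy) (Span.collinear x′y′) xx′ (code-injective s))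
          x≉y x≉x′

      go : (e∥e′ : Dec (index e ≡ index e′)) (e∙g : Dec (pointCode e ≡ pointCode g)) →
        (f∥f′ : Dec (index f ≡ index f′)) (f∙h : Dec (pointCode f ≡ pointCode h)) →
        key e e′ g e∥e′ e∙g ≡ key f f′ h f∥f′ f∙h → Copy C₈ graph
      go (yes e∥e′) _ (yes f∥f′) _ eq =
        contradiction (linked-determined P Q i (sym e∥e′ ∙ i ∙ f∥f′) p (far-end i p s)) P≢Q
        where
        p = cong (proj₁ ∘ proj₂) eq
        s = cong (proj₁ ∘ proj₂ ∘ proj₂) eq
        i = cong (proj₂ ∘ proj₂ ∘ proj₂) eq
      go (no _) (yes e∙g) (no _) (yes f∙h) eq =
        contradiction (linked-determined P Q i i′ p (sym e∙g ∙ p ∙ f∙h)) P≢Q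
        where
        p  = cong (proj₁ ∘ proj₂) eq
        i  = cong (proj₁ ∘ proj₂ ∘ proj₂) eq
        i′ = cong (proj₂ ∘ proj₂ ∘ proj₂) eq
      go (no e∦e′) (no e∤g) (no _) (no _) eq =
        close i i′ e∦e′ (e∤g ∘ codeᵛ-cong)
          (λ x≋x′ → P≢Q (linked-determined P Q i i′ (codeᵛ-cong x≋x′)
                          (far-end i (codeᵛ-cong x≋x′) (proj₁ s×l))))
          (linked-span P) (linked-span Q) (proj₁ s×l) (proj₂ s×l)
        where
        s×l = combine-injective (shiftCode e g) (lineCode (index e′) (pointOf e))
                (shiftCode f h) (lineCode (index f′) (pointOf f)) (cong (proj₁ ∘ proj₂) eq)
        i  = cong (proj₁ ∘ proj₂ ∘ proj₂) eq
        i′ = cong (proj₂ ∘ proj₂ ∘ proj₂) eq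
      -- The remaining cases compare keys with different tags.
      go (yes _) _ (no _) (yes _) eq with () ← cong proj₁ eq
      go (yes _) _ (no _) (no _) eq with () ← cong proj₁ eq
      go (no _) (yes _) (yes _) _ eq with () ← cong proj₁ eq
      go (no _) (yes _) (no _) (no _) eq with () ← cong proj₁ eq
      go (no _) (no _) (yes _) _ eq with () ← cong proj₁ eq
      go (no _) (no _) (no _) (yes _) eq with () ← cong proj₁ eq

    many-edges⇒C₈ : 3 * q ^ 23 < m ^ 4 → Copy C₈ graph
    many-edges⇒C₈ 3q²³<m⁴
      with cherries , cherries! , cherry , m²≤ ← collisions pointCode (allFin m) (Unique.allFin⁺ m)
      with pairs , pairs! , linked , c²≤ ← collisions segmentCode cherries cherries!
      -- There are 3q⁷ keys: with more linked pairs than that, two of them share a key.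
      with 3 * (q ^ 5 * (q * q)) <? length pairs
    ... | no few = contradiction
      (count-arithmetic q m (length cherries) (length pairs)
        (subst (λ l → l * l ≤ q ^ 5 * length cherries) (length-tabulate {n = m} id) m²≤)
        c²≤ (ℕₚ.≮⇒≥ few))
      (ℕₚ.<⇒≱ 3q²³<m⁴)
    ... | yes many
      with ((e , e′) , (g , g′)) , ((f , f′) , (h , h′)) , P∈ , Q∈ , P≢Q , eq ← pigeonhole-list
        (encode ∘ keyOf) pairs! many
      = collision⇒C₈ (isLinked P∈) (isLinked Q∈) P≢Q
          (index e Fin.≟ index e′) (pointCode e Fin.≟ pointCode g)
          (index f Fin.≟ index f′) (pointCode f Fin.≟ pointCode h)
          (encode-injective (keyOf ((e , e′) , (g , g′))) (keyOf ((f , f′) , (h , h′))) eq)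
      where
      isLinked : ∀ {P} → P ∈ pairs → Linked P
      isLinked P∈ = let c∈ , c′∈ , eq = linked P∈ in record
        { cherry₁ = proj₂ (proj₂ (cherry c∈))
        ; cherry₂ = proj₂ (proj₂ (cherry c′∈))
        ; segmentCode≡ = eq
        }

-- From edge density to the fourth-power bound, and the theorem.

δn≤m⇒n≤m*↧δ : ∀ (δ : ℚ) → 0ℚ ℚ.< δ → ∀ n m → δ ℚ.* (+ n / 1) ℚ.≤ + m / 1 → n ≤ m * ↧ₙ δ
δn≤m⇒n≤m*↧δ δ@(mkℚ (+ zero) _ _) (ℚ.*<* (ℤ.+<+ ()))
δn≤m⇒n≤m*↧δ δ@(mkℚ (ℤ.-[1+ _ ]) _ _) (ℚ.*<* ())
-- The numerator of δ is at least one, so n is at most the left side of the hypothesis cleared of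
-- denominators.
δn≤m⇒n≤m*↧δ δ@(mkℚ +[1+ a ] b-1 _) _ n m δn≤m = begin
  n               ≤⟨ ℕₚ.m≤m+n n (a * n) ⟩
  suc a * n       ≤⟨ ℤ.drop‿+≤+ (subst₂ ℤ._≤_ lhs rhs (ℚᵘ.drop-*≤* unnormalised)) ⟩
  m * suc b-1     ∎
  where
  open ℕₚ.≤-Reasoning

  unnormalised : toℚᵘ δ ℚᵘ.* ℚᵘ.mkℚᵘ (+ n) 0 ℚᵘ.≤ ℚᵘ.mkℚᵘ (+ m) 0
  unnormalised = ℚᵘ.≤-respˡ-≃
    (ℚᵘ.≃-trans (ℚ.toℚᵘ-homo-* δ (+ n / 1))
                (ℚᵘ.*-congˡ {toℚᵘ δ} (ℚ.toℚᵘ-fromℚᵘ (ℚᵘ.mkℚᵘ (+ n) 0))))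
    (ℚᵘ.≤-respʳ-≃ (ℚ.toℚᵘ-fromℚᵘ (ℚᵘ.mkℚᵘ (+ m) 0)) (ℚ.toℚᵘ-mono-≤ δn≤m))

  lhs : +[1+ a ] ℤ.* + n ℤ.* + 1 ≡ + (suc a * n)
  lhs = ≡.trans (ℤ.*-identityʳ (+[1+ a ] ℤ.* + n)) (≡.sym (ℤ.pos-* (suc a) n))

  rhs : + m ℤ.* + (suc b-1 * 1) ≡ + (m * suc b-1)
  rhs = ≡.trans (cong (λ k → + m ℤ.* + k) (ℕₚ.*-identityʳ (suc b-1))) (≡.sym (ℤ.pos-* m (suc b-1)))

-- Otherwise m⁴ ≤ 3q²³, and the fourth power of q⁶ ≤ mb would give q²⁴ ≤ 3b⁴q²³, that is q ≤ 3b⁴.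
dense⇒many : ∀ q m b → 3 * b ^ 4 < q → q ^ 6 ≤ m * b → 3 * q ^ 23 < m ^ 4
dense⇒many q m b 3b⁴<q q⁶≤mb = ℕₚ.≰⇒> λ m⁴≤3q²³ → ℕₚ.<⇒≱ 3b⁴<q
  (ℕₚ.*-cancelʳ-≤ q (3 * b ^ 4) (q ^ 23) {{ℕₚ.m^n≢0 q 23 {{>-nonZero (ℕₚ.≤-<-trans z≤n 3b⁴<q)}}}} (begin
    q * q ^ 23          ≡⟨ ℕₚ.^-*-assoc q 6 4 ⟨
    (q ^ 6) ^ 4         ≤⟨ ℕₚ.^-monoˡ-≤ 4 q⁶≤mb ⟩
    (m * b) ^ 4         ≡⟨ solve 2 (λ m b → (m :* b) :^ 4 := m :^ 4 :* b :^ 4) ≡.refl m b ⟩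
    m ^ 4 * b ^ 4       ≤⟨ ℕₚ.*-monoˡ-≤ (b ^ 4) m⁴≤3q²³ ⟩
    3 * q ^ 23 * b ^ 4  ≡⟨ solve 2 (λ x y → con 3 :* x :* y := con 3 :* y :* x) ≡.refl (q ^ 23) (b ^ 4) ⟩
    3 * b ^ 4 * q ^ 23  ∎))
  where
  open ℕₚ.≤-Reasoning
  open +-*-Solver using (solve; con; _:*_; _:^_; _:=_)

theorem3p1 : (∀ (δ : ℚ) → 0ℚ ℚ.< δ →
    ∃[ q₀ ] ∀ (q : ℕ) → q₀ ≤ q → IsPrimePower q →
    ∀ (𝔽 : HeytingField 0ℓ 0ℓ 0ℓ) → HasSize (fieldSetoid 𝔽) q →
    let open Affine 𝔽 in
    ∀ (d : Fin q → Point) →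
    (∀ i → ¬ (d i ≋ 0ᵛ)) →
    (∀ i j → i ≢ j → ¬ Parallel (d i) (d j)) →
    ∀ (H : Subgraph (incidenceGraph d)) (m : ℕ) →
    HasEdges (Subgraph.graph H) m →
    δ ℚ.* (+ (q ^ 6) / 1) ℚ.≤ + m / 1 →
    Copy C₈ (Subgraph.graph H))
    × (∃[ K ] ∃[ q₀ ] ∀ (q : ℕ) → q₀ ≤ q → IsPrimePower q →
    ∀ (𝔽 : HeytingField 0ℓ 0ℓ 0ℓ) → HasSize (fieldSetoid 𝔽) q →
    let open Affine 𝔽 in
    ∀ (d : Fin q → Point) →
    (∀ i → ¬ (d i ≋ 0ᵛ)) →
    (∀ i j → i ≢ j → ¬ Parallel (d i) (d j)) →
    ∀ (m : ℕ) → Is-ex (incidenceGraph d) C₈ m →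
    m ^ 4 ≤ K ^ 4 * q ^ 23)
theorem3p1 =
    -- The threshold is 3b⁴ + 1 with b the denominator of δ; `suc` turns `q₀ ≤ q` into the strict
    -- inequality of `dense⇒many`.
    (λ δ 0<δ → suc (3 * ↧ₙ δ ^ 4) , λ q q₀≤q _ 𝔽 size d d≉0 d∦ H m edges dense →
      IncidenceSubgraph.Counting.many-edges⇒C₈ 𝔽 size d d≉0 d∦ H edges
        (dense⇒many q m (↧ₙ δ) q₀≤q (δn≤m⇒n≤m*↧δ δ 0<δ (q ^ 6) m dense)))
  -- K = 2 because 3 ≤ 16 = 2⁴; the count is applied to the extremal subgraph itself.
  , (2 , 0 , λ q _ _ 𝔽 size d d≉0 d∦ m ((H , free , edges) , _) →
      ℕₚ.≤-trans
        (ℕₚ.≮⇒≥ (λ 3q²³<m⁴ →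
          free (IncidenceSubgraph.Counting.many-edges⇒C₈ 𝔽 size d d≉0 d∦ H edges 3q²³<m⁴)))
        (ℕₚ.*-monoˡ-≤ (q ^ 23) {3} {16} (ℕₚ.m≤m+n 3 13)))
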